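{- For all integers $m\ge 336$, $b(m)=\lfloor m/2\rfloor+1$. That is: every connected bipartite graph with $m$ vertices in each part and minimum degree at least $\lfloor m/2\rfloor+1$ is Class 0, and there exists a connected bipartite graph with $m$ vertices in each part and minimum degree at least $\lfloor m/2\rfloor$ that is not Class 0.
   Context: Let $G=(V,E)$ be a connected graph. A configuration $C$ of pebbles on $G$ is a function $C:V\to\mathbb{Z}_{\ge 0}$ (the number of pebbles on each vertex); its size is $|C|=\sum_{v\in V}C(v)$. A pebbling step from a vertex $u$ to an adjacent vertex $v$ removes two pebbles from $u$ and adds one pebble to $v$. A configuration is $r$-solvable if a pebble can be placed on the root vertex $r$ via a (possibly empty) sequence of pebbling steps, and solvable if it is $r$-solvable for every $r\in V$. The pebbling number $\pi(G)$ is the least $t$ such that every configuration of size $t$ on $G$ is solvable. A graph $G$ is Class 0 if $\pi(G)=|V(G)|$. Let $\mathbf{B}(m)$ denote the set of all connected bipartite graphs with $m$ vertices in each part, and let $b(m)$ be the minimum number $b$ such that every $G\in\mathbf{B}(m)$ having minimum degree at least $b$ is Class 0. -}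

module Defs where

open import Data.Nat using (ℕ; zero; suc; _+_; _∸_; _≤_; _<_; _<ᵇ_)
open import Data.Bool using (Bool; true; false; T; if_then_else_)
open import Data.Fin using (Fin; toℕ; _≟_)
open import Data.List using (List; map; allFin)
open import Data.Nat.ListAction using (sum)
open import Data.Product using (Σ; _×_; _,_; ∃)
open import Relation.Nullary using (¬_; does)
open import Relation.Binary.PropositionalEquality using (_≡_; _≢_)
open import Relation.Binary.Construct.Closure.ReflexiveTransitive using (Star)

record Graph (n : ℕ) : Set where
  field
    adj   : Fin n → Fin n → Bool
    sym   : ∀ u v → adj u v ≡ adj v u
    irrefl : ∀ v → adj v v ≡ false
open Graph public

Adj : ∀ {n} → Graph n → Fin n → Fin n → Set
Adj G u v = T (adj G u v)

Connected : ∀ {n} → Graph n → Set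
Connected {n} G = ∀ (u v : Fin n) → Star (Adj G) u v

degree : ∀ {n} → Graph n → Fin n → ℕ
degree {n} G v = sum (map (λ w → if adj G v w then 1 else 0) (allFin n))

MinDegreeAtLeast : ∀ {n} → Graph n → ℕ → Set
MinDegreeAtLeast {n} G b = ∀ (v : Fin n) → b ≤ degree G v

-- Bipartite with m vertices in each part: vertices Fin (m + m), part A
-- = indices < m, part B = indices ≥ m; every edge goes between the parts.
side : ∀ m → Fin (m + m) → Bool
side m i = toℕ i <ᵇ m

InB : ∀ m → Graph (m + m) → Set
InB m G = (∀ u v → Adj G u v → side m u ≢ side m v) × Connected G

Config : ℕ → Set
Config n = Fin n → ℕ

size : ∀ {n} → Config n → ℕ
size {n} C = sum (map C (allFin n))

move : ∀ {n} → Config n → Fin n → Fin n → Config n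
move C u v w =
  if does (w ≟ u) then C w ∸ 2
  else if does (w ≟ v) then suc (C w) else C w

data Step {n} (G : Graph n) (C : Config n) : Config n → Set where
  step : ∀ {u v} → Adj G u v → 2 ≤ C u → Step G C (move C u v)

Solvable-at : ∀ {n} → Graph n → Config n → Fin n → Set
Solvable-at G C r = ∃ λ C' → Star (Step G) C C' × 1 ≤ C' r

Solvable : ∀ {n} → Graph n → Config n → Set
Solvable {n} G C = ∀ (r : Fin n) → Solvable-at G C r

AllSolvable : ∀ {n} → Graph n → ℕ → Set
AllSolvable {n} G t = ∀ (C : Config n) → size C ≡ t → Solvable G C

PebblingNumber : ∀ {n} → Graph n → ℕ → Set
PebblingNumber G t = AllSolvable G t × (∀ s → s < t → ¬ AllSolvable G s)

Class0 : ∀ {n} → Graph n → Set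
Class0 {n} G = PebblingNumber G n

{-# OPTIONS --safe #-}
-- Write h = ⌊m/2⌋. Two vertices of the same part have a common neighbour, so
-- every vertex is within distance 3 of the root r and 8 pebbles on one vertex
-- suffice. Let F = ∑ ⌊C v /2⌋. If F ≥ 28, double counting gives a vertex that can
-- collect 8 pebbles from its neighbours. Otherwise C v + [C v = 0] ≤ 1 + 2⌊C v /2⌋
-- leaves at most 2F ≤ 54 empty vertices. If F ≤ 1, at most one vertex other than r
-- is empty, and a pebble can be relayed to r along vertices carrying one pebble.
-- If F ≥ 2, two moves at most produce u ≠ u′ with two pebbles each in the part of
-- r. Fix a pebbled neighbour v of u. Every pebbled w ~ v shares a neighbour with
-- r, and there are more such w than empty vertices, so either r is reached along
-- u, v, w, x, or two of them, w and w′, share the same x ~ r. As r, u and w have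
-- degree > m/2, two of them have a common pebbled neighbour; unless r is reached
-- this way, u feeds x through w, and u′ feeds x through w′, and then x feeds r.
--
-- For sharpness, a cut vertex x destroys Class 0: with no pebble on x nor on a
-- root r beyond it, three pebbles on a vertex y on this side and one pebble
-- elsewhere, x never holds two pebbles.

module Submission where

open import Defs renaming (sym to adj-sym)
open import Data.Bool using (Bool; true; false; T; not; _xor_; if_then_else_)
open import Data.Bool.Properties using (T?; ¬-not) renaming (_≟_ to _≟ᵇ_)
open import Data.Empty using (⊥-elim)
open import Data.Fin using (Fin; zero; suc; toℕ; fromℕ<; splitAt; _↑ˡ_; _↑ʳ_; _≟_)
open import Data.Fin.Properties using (splitAt-↑ˡ; splitAt-↑ʳ; splitAt⁻¹-↑ˡ; toℕ-fromℕ<)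
open import Data.List using (allFin; tabulate; map)
open import Data.List.Properties using (map-tabulate)
import Data.Nat.ListAction as ListAction
open import Data.Maybe using (is-just)
open import Data.Nat using (ℕ; zero; suc; _+_; _*_; _∸_; _/_; _≤_; _<_; _<?_; _≤?_; _<ᵇ_; z≤n; s≤s; s≤s⁻¹; ⌊_/2⌋; _%_)
open import Data.Nat.DivMod using (m≡m%n+[m/n]*n; m%n<n; m/n*n≤m; /-monoˡ-≤)
open import Data.Nat.Properties renaming (_≟_ to _≟ⁿ_)
open import Data.Nat.Tactic.RingSolver using (solve-∀)
open import Data.Product using (_×_; _,_; ∃; Σ)
open import Data.Sum using (_⊎_; inj₁; inj₂; isInj₁; reduce)
open import Data.Unit using (tt)
open import Function using (_∘_; const)
open import Relation.Binary.Construct.Closure.ReflexiveTransitive using (Star; ε; _◅_; _◅◅_; reverse)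
open import Relation.Binary.PropositionalEquality using (_≡_; _≢_; refl; sym; trans; cong; cong₂; subst; module ≡-Reasoning)
open import Relation.Nullary using (¬_; Dec; yes; no; does; _×-dec_)
open import Relation.Nullary.Decidable using (dec-true; dec-false)
open import Algebra.Properties.Semiring.Sum +-*-semiring using (∑-distrib-+; ∑-comm; *-distribˡ-sum; sum-cong-≗; *-distribʳ-sum) renaming (sum to ∑)

-- Indicator functions

⟦_⟧ : Bool → ℕ
⟦ b ⟧ = if b then 1 else 0

T⇒⟦⟧≡1 : ∀ {b} → T b → ⟦ b ⟧ ≡ 1
T⇒⟦⟧≡1 {true} _ = refl

δ : ∀ {n} → Fin n → Fin n → ℕ
δ u v = ⟦ does (u ≟ v) ⟧

δ-refl : ∀ {n} (u : Fin n) → δ u u ≡ 1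
δ-refl u with u ≟ u
... | yes _   = refl
... | no  u≢u = ⊥-elim (u≢u refl)

δ-≢ : ∀ {n} {u v : Fin n} → u ≢ v → δ u v ≡ 0
δ-≢ {u = u} {v} u≢v with u ≟ v
... | yes u≡v = ⊥-elim (u≢v u≡v)
... | no  _   = refl

δ≡0⇒≢ : ∀ {n} {u v : Fin n} → δ u v ≡ 0 → u ≢ v
δ≡0⇒≢ {u = u} eq refl with () ← trans (sym (δ-refl u)) eq

-- Finite sums

listSum-tabulate : ∀ {n} (f : Fin n → ℕ) → ListAction.sum (tabulate f) ≡ ∑ f
listSum-tabulate {zero}  f = refl
listSum-tabulate {suc n} f = cong (f zero +_) (listSum-tabulate (f ∘ suc))

listSum-allFin : ∀ {n} (f : Fin n → ℕ) → ListAction.sum (map f (allFin n)) ≡ ∑ f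
listSum-allFin f = trans (cong ListAction.sum (map-tabulate (λ i → i) f)) (listSum-tabulate f)

∑-mono : ∀ {n} {f g : Fin n → ℕ} → (∀ i → f i ≤ g i) → ∑ f ≤ ∑ g
∑-mono {zero}  f≤g = z≤n
∑-mono {suc n} f≤g = +-mono-≤ (f≤g zero) (∑-mono (f≤g ∘ suc))

∑-const : ∀ n c → ∑ {n} (const c) ≡ n * c
∑-const zero    c = refl
∑-const (suc n) c = cong (c +_) (∑-const n c)

∑-δ : ∀ {n} (u : Fin n) → ∑ (δ u) ≡ 1
∑-δ {suc n} zero    = cong suc (trans (∑-const n 0) (*-zeroʳ n))
∑-δ         (suc u) = ∑-δ u

term≤∑ : ∀ {n} (f : Fin n → ℕ) i → f i ≤ ∑ f
term≤∑ f zero    = m≤m+n _ _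
term≤∑ f (suc i) = m≤n⇒m≤o+n _ (term≤∑ (f ∘ suc) i)

∑-<⇒∃< : ∀ {n} (g f : Fin n → ℕ) → ∑ g < ∑ f → ∃ λ i → g i < f i
∑-<⇒∃< {suc n} g f lt with g zero <? f zero
... | yes g₀<f₀ = zero , g₀<f₀
... | no  g₀≮f₀ with i , gᵢ<fᵢ ← ∑-<⇒∃< (g ∘ suc) (f ∘ suc)
        (+-cancelˡ-< (g zero) _ _ (<-≤-trans lt (+-monoˡ-≤ _ (≮⇒≥ g₀≮f₀)))) = suc i , gᵢ<fᵢ

∑-pos⇒∃pos : ∀ {n} (f : Fin n → ℕ) → 0 < ∑ f → ∃ λ i → 0 < f i
∑-pos⇒∃pos {n} f 0<∑f =
  ∑-<⇒∃< (const 0) f (subst (_< ∑ f) (sym (trans (∑-const n 0) (*-zeroʳ n))) 0<∑f)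

∑-<ᵇ : ∀ {n} k → k ≤ n → ∑ {n} (λ i → ⟦ toℕ i <ᵇ k ⟧) ≡ k
∑-<ᵇ {n} zero    _         = trans (∑-const n 0) (*-zeroʳ n)
∑-<ᵇ     (suc k) (s≤s k≤n) = cong suc (∑-<ᵇ k k≤n)

⟦not⟧ : ∀ b → ⟦ b ⟧ + ⟦ not b ⟧ ≡ 1
⟦not⟧ true  = refl
⟦not⟧ false = refl

∑-not : ∀ {n} (p : Fin n → Bool) → ∑ (λ i → ⟦ p i ⟧) + ∑ (λ i → ⟦ not (p i) ⟧) ≡ n
∑-not {n} p = trans (sym (∑-distrib-+ (λ i → ⟦ p i ⟧) _))
  (trans (sum-cong-≗ (⟦not⟧ ∘ p)) (trans (∑-const n 1) (*-identityʳ n)))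

-- Pebbling

move-source : ∀ {n} (C : Config n) u v → move C u v u ≡ C u ∸ 2
move-source C u v with u ≟ u
... | yes _   = refl
... | no  u≢u = ⊥-elim (u≢u refl)

move-target : ∀ {n} (C : Config n) {u v} → u ≢ v → move C u v v ≡ suc (C v)
move-target C {u} {v} u≢v with v ≟ u | v ≟ v
... | yes v≡u | _       = ⊥-elim (u≢v (sym v≡u))
... | no  _   | yes _   = refl
... | no  _   | no  v≢v = ⊥-elim (v≢v refl)

move-≢ : ∀ {n} (C : Config n) u v {t} → t ≢ u → C t ≤ move C u v t
move-≢ C u v {t} t≢u with t ≟ u | t ≟ v
... | yes t≡u | _     = ⊥-elim (t≢u t≡u)
... | no  _   | yes _ = n≤1+n _
... | no  _   | no  _ = ≤-refl

move-≢≢ : ∀ {n} (C : Config n) u v {t} → t ≢ u → t ≢ v → move C u v t ≡ C t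
move-≢≢ C u v {t} t≢u t≢v with t ≟ u | t ≟ v
... | yes t≡u | _       = ⊥-elim (t≢u t≡u)
... | no  _   | yes t≡v = ⊥-elim (t≢v t≡v)
... | no  _   | no  _   = refl

adj⇒≢ : ∀ {n} (G : Graph n) {u v} → Adj G u v → u ≢ v
adj⇒≢ G {u} u~u refl = subst T (irrefl G u) u~u

adj-flip : ∀ {n} (G : Graph n) {u v} → Adj G u v → Adj G v u
adj-flip G {u} {v} = subst T (adj-sym G u v)

0<⌊c/2⌋⇒2≤c : ∀ {c} → 0 < ⌊ c /2⌋ → 2 ≤ c
0<⌊c/2⌋⇒2≤c {suc (suc _)} _ = s≤s (s≤s z≤n)

module _ {n} (G : Graph n) where

  after : ∀ {C C′ r} → Star (Step G) C C′ → Solvable-at G C′ r → Solvable-at G C r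
  after s (D , t , 1≤D) = D , s ◅◅ t , 1≤D

  move⁺ : ∀ (C : Config n) {u v} → Adj G u v → C v < move C u v v
  move⁺ C u~v = ≤-reflexive (sym (move-target C (adj⇒≢ G u~v)))

  solve₁ : ∀ (C : Config n) {u r} → Adj G u r → 2 ≤ C u → Solvable-at G C r
  solve₁ C u~r 2≤u = _ , step u~r 2≤u ◅ ε , ≤-trans (s≤s z≤n) (move⁺ C u~r)

  solve₂ : ∀ (C : Config n) {u v r} → Adj G u v → Adj G v r → 2 ≤ C u → 1 ≤ C v → Solvable-at G C r
  solve₂ C u~v v~r 2≤u 1≤v = after (step u~v 2≤u ◅ ε) (solve₁ (move C _ _) v~r (≤-trans (s≤s 1≤v) (move⁺ C u~v)))

  -- Each inner vertex already holds a pebble, so the one passed to it completes a pair that can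
  -- move on. The inequality keeps the walk from returning to `u`, whose pair is spent.
  solve₃ : ∀ (C : Config n) {u v w r} → Adj G u v → Adj G v w → Adj G w r → w ≢ u →
           2 ≤ C u → 1 ≤ C v → 1 ≤ C w → Solvable-at G C r
  solve₃ C u~v v~w w~r w≢u 2≤u 1≤v 1≤w = after (step u~v 2≤u ◅ ε)
    (solve₂ (move C _ _) v~w w~r (≤-trans (s≤s 1≤v) (move⁺ C u~v)) (≤-trans 1≤w (move-≢ C _ _ w≢u)))

  solve₄ : ∀ (C : Config n) {u v w x r} → Adj G u v → Adj G v w → Adj G w x → Adj G x r →
           w ≢ u → x ≢ u → x ≢ v →
           2 ≤ C u → 1 ≤ C v → 1 ≤ C w → 1 ≤ C x → Solvable-at G C r
  solve₄ C u~v v~w w~x x~r w≢u x≢u x≢v 2≤u 1≤v 1≤w 1≤x = after (step u~v 2≤u ◅ ε)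
    (solve₃ (move C _ _) v~w w~x x~r x≢v (≤-trans (s≤s 1≤v) (move⁺ C u~v))
      (≤-trans 1≤w (move-≢ C _ _ w≢u)) (≤-trans 1≤x (move-≢ C _ _ x≢u)))

  -- For a target `x` that may be empty: two relays put a pair on it. The last component allows the
  -- second relay to run after the first.
  relay : ∀ (C : Config n) {u v w x} → Adj G u v → Adj G v w → Adj G w x →
          w ≢ u → x ≢ u → x ≢ v → 2 ≤ C u → 1 ≤ C v → 1 ≤ C w →
          ∃ λ C′ → Star (Step G) C C′ × C x < C′ x ×
                   (∀ t → t ≢ u → t ≢ v → t ≢ w → C t ≤ C′ t)
  relay C {u} {v} {w} {x} u~v v~w w~x w≢u x≢u x≢v 2≤u 1≤v 1≤w =
    C₃ , step u~v 2≤u ◅ step v~w 2≤v ◅ step w~x 2≤w ◅ ε ,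
    <-≤-trans (s≤s (≤-trans (move-≢ C u v x≢u) (move-≢ C₁ v w x≢v))) (move⁺ C₂ w~x) ,
    λ t t≢u t≢v t≢w → ≤-trans (move-≢ C u v t≢u)
      (≤-trans (move-≢ C₁ v w t≢v) (move-≢ C₂ w x t≢w))
    where
    C₁ = move C u v
    2≤v : 2 ≤ C₁ v
    2≤v = ≤-trans (s≤s 1≤v) (move⁺ C u~v)
    C₂ = move C₁ v w
    2≤w : 2 ≤ C₂ w
    2≤w = ≤-trans (s≤s (≤-trans 1≤w (move-≢ C u v w≢u))) (move⁺ C₁ v~w)
    C₃ = move C₂ w x

  a : Fin n → Fin n → ℕ
  a u v = ⟦ adj G u v ⟧

  -- The sum counts the moves into `v` that are available. Making one of them lowers it by at most
  -- 1, so `k` of them can be made in turn.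
  collect : ∀ k (C : Config n) v → k ≤ ∑ (λ w → a v w * ⌊ C w /2⌋) →
            ∃ λ C′ → Star (Step G) C C′ × C v + k ≤ C′ v
  collect zero    C v _   = C , ε , ≤-reflexive (+-identityʳ _)
  collect (suc k) C v k<∑ with ∑-pos⇒∃pos (λ w → a v w * ⌊ C w /2⌋) (≤-trans (s≤s z≤n) k<∑)
  ... | w , pos with adj G v w in vw
  ... | true =
    let C′ , s , le = collect k C₁ v (s≤s⁻¹ (≤-trans k<∑ loss)) in
    C′ , step (adj-flip G v~w) 2≤w ◅ s ,
    ≤-trans (≤-reflexive (+-suc (C v) k)) (≤-trans (+-monoˡ-≤ k (move⁺ C (adj-flip G v~w))) le)
    where
    v~w : Adj G v w
    v~w = subst T (sym vw) tt
    2≤w : 2 ≤ C w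
    2≤w = 0<⌊c/2⌋⇒2≤c (≤-trans pos (≤-reflexive (*-identityˡ _)))
    C₁ = move C w v
    halve : ∀ {c} → 2 ≤ c → ⌊ c /2⌋ ≡ suc ⌊ c ∸ 2 /2⌋
    halve (s≤s (s≤s _)) = refl
    pointwise : ∀ t → a v t * ⌊ C t /2⌋ ≤ δ w t + a v t * ⌊ C₁ t /2⌋
    pointwise t with w ≟ t
    ... | yes refl rewrite vw | move-source C w v = ≤-reflexive
          (trans (*-identityˡ _) (trans (halve 2≤w) (cong suc (sym (*-identityˡ _)))))
    ... | no  w≢t = *-monoʳ-≤ (a v t) (⌊n/2⌋-mono (move-≢ C w v (w≢t ∘ sym)))
    loss : ∑ (λ t → a v t * ⌊ C t /2⌋) ≤ suc (∑ (λ t → a v t * ⌊ C₁ t /2⌋))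
    loss = ≤-trans (∑-mono pointwise) (≤-reflexive
      (trans (∑-distrib-+ (δ w) (λ t → a v t * ⌊ C₁ t /2⌋)) (cong (_+ ∑ (λ t → a v t * ⌊ C₁ t /2⌋)) (∑-δ w))))

  concentrate : ∀ k (C : Config n) {u v} → Adj G u v → k + k ≤ C u →
                ∃ λ C′ → Star (Step G) C C′ × k ≤ C′ v
  concentrate k C {u} {v} u~v 2k≤u =
    let C′ , s , le = collect k C v (≤-trans k≤term (term≤∑ (λ w → a v w * ⌊ C w /2⌋) u)) in
    C′ , s , ≤-trans (m≤n+m k (C v)) le
    where
    k≤term : k ≤ a v u * ⌊ C u /2⌋
    k≤term rewrite T⇒⟦⟧≡1 (adj-flip G u~v) | *-identityˡ ⌊ C u /2⌋ =
      ≤-trans (≤-reflexive (n≡⌊n+n/2⌋ k)) (⌊n/2⌋-mono 2k≤u)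

unmovable : ∀ {n} (G : Graph n) {C C′ : Config n} → (∀ v → C v ≤ 1) → Star (Step G) C C′ → C′ ≡ C
unmovable G C≤1 ε                = refl
unmovable G C≤1 (step _ 2≤u ◅ _) = ⊥-elim (<⇒≱ 2≤u (C≤1 _))

-- With single pebbles on `s` vertices other than the root `zero`, no vertex holds a pair, so no
-- step exists and the root stays empty.
¬AllSolvable-< : ∀ {n} (G : Graph n) s → s < n → ¬ AllSolvable G s
¬AllSolvable-< {suc n} G s (s≤s s≤n) all =
  let C′ , st , 1≤r = all C (trans (listSum-allFin C) (∑-<ᵇ s s≤n)) zero in
  n≮0 (subst (λ D → 1 ≤ D zero) (unmovable G C≤1 st) 1≤r)
  where
  C : Config (suc n)
  C zero    = 0
  C (suc i) = ⟦ toℕ i <ᵇ s ⟧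
  ⟦⟧≤1 : ∀ b → ⟦ b ⟧ ≤ 1
  ⟦⟧≤1 true  = ≤-refl
  ⟦⟧≤1 false = z≤n
  C≤1 : ∀ v → C v ≤ 1
  C≤1 zero    = z≤n
  C≤1 (suc i) = ⟦⟧≤1 (toℕ i <ᵇ s)

-- Counting in the bipartite graph

𝟙 : ∀ {P : Set} → Dec P → ℕ
𝟙 d = ⟦ does d ⟧

𝟙≤1 : ∀ {P : Set} (d : Dec P) → 𝟙 d ≤ 1
𝟙≤1 (yes _) = ≤-refl
𝟙≤1 (no  _) = z≤n

𝟙-pos : ∀ {P : Set} (d : Dec P) → 0 < 𝟙 d → P
𝟙-pos (yes p) _ = p

𝟙-yes : ∀ {P : Set} (d : Dec P) → P → 𝟙 d ≡ 1
𝟙-yes (yes _) _ = refl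
𝟙-yes (no ¬p) p = ⊥-elim (¬p p)

¬T⇒⟦⟧≡0 : ∀ {b} → ¬ T b → ⟦ b ⟧ ≡ 0
¬T⇒⟦⟧≡0 {true}  ¬t = ⊥-elim (¬t tt)
¬T⇒⟦⟧≡0 {false} _  = refl

both : ∀ o p q → (T p → o ≡ 1) → (T q → o ≡ 1) → o < ⟦ p ⟧ + ⟦ q ⟧ → T p × T q
both o true  true  _ _ _  = tt , tt
both o true  false f _ lt = ⊥-elim (<-irrefl (f tt) lt)
both o false true  _ g lt = ⊥-elim (<-irrefl (g tt) lt)

-- Pigeonhole at one vertex: `o` indicates the part where neighbours can lie, `b` is the bad weight.
-- A positive `b` adds at least 2 on the left, which together with `o` covers all three indicators;
-- so `b` vanishes and a single indicator is not enough.
two-of : ∀ o b p q s → (T p → o ≡ 1) → (T q → o ≡ 1) → (T s → o ≡ 1) →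
         o + (b + b) < ⟦ p ⟧ + (⟦ q ⟧ + ⟦ s ⟧) →
         b ≡ 0 × ((T p × T q) ⊎ (T p × T s) ⊎ (T q × T s))
two-of o zero true  true  s     _ _ _ _  = refl , inj₁ (tt , tt)
two-of o zero true  false true  _ _ _ _  = refl , inj₂ (inj₁ (tt , tt))
two-of o zero false true  true  _ _ _ _  = refl , inj₂ (inj₂ (tt , tt))
two-of o zero true  false false f _ _ lt = ⊥-elim (<-irrefl (f tt) (subst (_< 1) (+-identityʳ o) lt))
two-of o zero false true  false _ f _ lt = ⊥-elim (<-irrefl (f tt) (subst (_< 1) (+-identityʳ o) lt))
two-of o zero false false true  _ _ f lt = ⊥-elim (<-irrefl (f tt) (subst (_< 1) (+-identityʳ o) lt))
two-of o (suc b) p q s f g k lt = ⊥-elim (<⇒≱ lt (≤-trans (bound p q s f g k)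
    (+-monoʳ-≤ o (s≤s (m≤n⇒m≤o+n b (s≤s z≤n))))))
  where
  bound : ∀ p q s → (T p → o ≡ 1) → (T q → o ≡ 1) → (T s → o ≡ 1) →
          ⟦ p ⟧ + (⟦ q ⟧ + ⟦ s ⟧) ≤ o + 2
  bound false false false _ _ _ = z≤n
  bound true  q     s     f _ _ rewrite f tt = s≤s (+-mono-≤ (𝟙≤1 (T? q)) (𝟙≤1 (T? s)))
  bound false true  s     _ f _ rewrite f tt = s≤s (≤-trans (𝟙≤1 (T? s)) (s≤s z≤n))
  bound false false true  _ _ f rewrite f tt = s≤s z≤n

≢⇒xor : ∀ {s t : Bool} → s ≢ t → ⟦ s xor t ⟧ ≡ 1
≢⇒xor {true}  {true}  s≢t = ⊥-elim (s≢t refl)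
≢⇒xor {true}  {false} s≢t = refl
≢⇒xor {false} {true}  s≢t = refl
≢⇒xor {false} {false} s≢t = ⊥-elim (s≢t refl)

≢-≢⇒≡ : ∀ {s t v : Bool} → s ≢ t → t ≢ v → s ≡ v
≢-≢⇒≡ {s} {t} {v} s≢t t≢v = trans (¬-not s≢t) (sym (¬-not (t≢v ∘ sym)))

isZero : ℕ → ℕ
isZero zero    = 1
isZero (suc _) = 0

c+isZero≤1+2⌊c/2⌋ : ∀ c → c + isZero c ≤ suc (⌊ c /2⌋ + ⌊ c /2⌋)
c+isZero≤1+2⌊c/2⌋ zero          = ≤-refl
c+isZero≤1+2⌊c/2⌋ (suc zero)    = ≤-refl
c+isZero≤1+2⌊c/2⌋ (suc (suc c))
  rewrite +-identityʳ c | +-suc ⌊ c /2⌋ ⌊ c /2⌋ = s≤s (s≤s (m+n≤o⇒m≤o c (c+isZero≤1+2⌊c/2⌋ c)))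

2≤⌊c/2⌋⇒4≤c : ∀ {c} → 2 ≤ ⌊ c /2⌋ → 4 ≤ c
2≤⌊c/2⌋⇒4≤c {suc (suc c)} (s≤s 1≤f) = s≤s (s≤s (0<⌊c/2⌋⇒2≤c 1≤f))

-- Used to locate a second pair of pebbles: it sits either on the vertex of the first pair or
-- elsewhere.
δ<-cases : ∀ {n} (u v : Fin n) {c} → δ u v < c → (u ≡ v × 2 ≤ c) ⊎ (u ≢ v × 1 ≤ c)
δ<-cases u v lt with u ≟ v
... | yes u≡v = inj₁ (u≡v , lt)
... | no  u≢v = inj₂ (u≢v , lt)

-- bad marks the vertices that may be empty; as a weight (rather than a set) it
-- is updated by adding δ.
Covers : ∀ {n} → Config n → (Fin n → ℕ) → Set
Covers C bad = ∀ v → bad v ≡ 0 → 1 ≤ C v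

covers-isZero : ∀ {n} (C : Config n) → Covers C (isZero ∘ C)
covers-isZero C v eq with suc _ ← C v = s≤s z≤n

-- Solvability in dense bipartite graphs

module Dense (m h : ℕ) (168≤h : 168 ≤ h) (m≤1+2h : m ≤ suc (h + h))
  (G : Graph (m + m)) (bipartite : ∀ u v → Adj G u v → side m u ≢ side m v)
  (min-degree : ∀ u → h < ∑ (a G u)) (r : Fin (m + m)) where

  V : Set
  V = Fin (m + m)

  infix 4 _~_
  _~_ : V → V → Set
  _~_ = Adj G

  flip : ∀ {u v} → u ~ v → v ~ u
  flip = adj-flip G

  Solved : Config (m + m) → Set
  Solved C = Solvable-at G C r

  halves : Config (m + m) → ℕ
  halves C = ∑ (λ v → ⌊ C v /2⌋)

  same-side : ∀ {u v w} → u ~ v → v ~ w → side m u ≡ side m w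
  same-side u~v v~w = ≢-≢⇒≡ (bipartite _ _ u~v) (bipartite _ _ v~w)

  opposite : Bool → V → ℕ
  opposite s v = ⟦ s xor side m v ⟧

  ∑-opposite : ∀ s → ∑ (opposite s) ≡ m
  ∑-opposite false = ∑-<ᵇ m (m≤m+n m m)
  ∑-opposite true  = +-cancelˡ-≡ m _ _
    (trans (cong (_+ ∑ (opposite true)) (sym (∑-<ᵇ m (m≤m+n m m)))) (∑-not (side m)))

  opposite-nbr : ∀ {s u v} → s ≡ side m u → u ~ v → opposite s v ≡ 1
  opposite-nbr refl u~v = ≢⇒xor (bipartite _ _ u~v)

  -- Both neighbourhoods lie in the opposite part, which has at most 2h + 1 vertices, and their
  -- sizes add up to at least 2h + 2.
  common : ∀ u v → side m u ≡ side m v → ∃ λ x → u ~ x × v ~ x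
  common u v su≡sv =
    let x , lt = ∑-<⇒∃< (opposite (side m u)) (λ x → a G u x + a G v x) more
    in  x , both _ _ _ (opposite-nbr refl) (opposite-nbr su≡sv) lt
    where
    open ≤-Reasoning
    more : ∑ (opposite (side m u)) < ∑ (λ x → a G u x + a G v x)
    more = begin-strict
      ∑ (opposite (side m u))        ≡⟨ ∑-opposite (side m u) ⟩
      m                              ≤⟨ m≤1+2h ⟩
      suc h + h                      <⟨ +-mono-≤-< (min-degree u) (min-degree v) ⟩
      ∑ (a G u) + ∑ (a G v)          ≡⟨ ∑-distrib-+ (a G u) (a G v) ⟨
      ∑ (λ x → a G u x + a G v x)    ∎

  -- The three degrees add up to at least 3h + 3. The opposite part, with twice the bad weight
  -- added, weighs at most 2h + 1 + 116, which is at most 3h + 1.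
  two-of-three : ∀ u v w bad → side m u ≡ side m v → side m u ≡ side m w → ∑ bad ≤ 58 →
    ∃ λ x → bad x ≡ 0 × ((u ~ x × v ~ x) ⊎ (u ~ x × w ~ x) ⊎ (v ~ x × w ~ x))
  two-of-three u v w bad su≡sv su≡sw few =
    let x , lt = ∑-<⇒∃< (λ x → opp x + (bad x + bad x)) (λ x → a G u x + (a G v x + a G w x)) more
    in  x , two-of _ (bad x) _ _ _ (opposite-nbr refl) (opposite-nbr su≡sv) (opposite-nbr su≡sw) lt
    where
    opp = opposite (side m u)
    open ≤-Reasoning
    more : ∑ (λ x → opp x + (bad x + bad x)) < ∑ (λ x → a G u x + (a G v x + a G w x))
    more = begin-strict
      ∑ (λ x → opp x + (bad x + bad x))
        ≡⟨ trans (∑-distrib-+ opp (λ x → bad x + bad x)) (cong (∑ opp +_) (∑-distrib-+ bad bad)) ⟩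
      ∑ opp + (∑ bad + ∑ bad)
        ≤⟨ +-mono-≤ (≤-trans (≤-reflexive (∑-opposite (side m u))) m≤1+2h) (+-mono-≤ few few) ⟩
      suc (h + h) + 116
        ≤⟨ +-monoʳ-≤ (suc (h + h)) (≤-trans (m≤m+n 116 52) 168≤h) ⟩
      suc (h + h) + h
        ≡⟨ cong suc (+-assoc h h h) ⟩
      suc h + (h + h)
        <⟨ +-mono-≤-< (min-degree u) (+-mono-< (min-degree v) (min-degree w)) ⟩
      ∑ (a G u) + (∑ (a G v) + ∑ (a G w))
        ≡⟨ trans (∑-distrib-+ (a G u) (λ x → a G v x + a G w x)) (cong (∑ (a G u) +_) (∑-distrib-+ (a G v) (a G w))) ⟨
      ∑ (λ x → a G u x + (a G v x + a G w x)) ∎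

  nbr-avoiding : ∀ bad → ∑ bad ≤ 168 → ∀ u → ∃ λ v → u ~ v × bad v ≡ 0
  nbr-avoiding bad few u =
    let v , lt = ∑-<⇒∃< bad (a G u) (≤-<-trans (≤-trans few 168≤h) (min-degree u))
    -- An indicator that strictly exceeds `bad v` is 1, and then `bad v` is 0.
    in  v , 𝟙-pos (T? (adj G u v)) (≤-trans (s≤s z≤n) lt) ,
        n≤0⇒n≡0 (s≤s⁻¹ (≤-trans lt (𝟙≤1 (T? (adj G u v)))))

  solve-4 : ∀ C v → side m v ≡ side m r → 4 ≤ C v → Solved C
  solve-4 C v sv 4≤v =
    let x , v~x , r~x = common v r sv
        C′ , s , 2≤x  = concentrate G 2 C v~x 4≤v
    in  after G s (solve₁ G C′ (flip r~x) 2≤x)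

  solve-8 : ∀ C v → 8 ≤ C v → Solved C
  solve-8 C v 8≤v with side m v ≟ᵇ side m r
  ... | yes sv = solve-4 C v sv (≤-trans (m≤m+n 4 4) 8≤v)
  ... | no  sv =
    let x , v~x , _  = nbr-avoiding (const 0) (≤-trans (≤-reflexive (trans (∑-const (m + m) 0) (*-zeroʳ (m + m)))) z≤n) v
        C′ , s , 4≤x = concentrate G 4 C v~x 8≤v
    in  after G s (solve-4 C′ x (≢-≢⇒≡ (bipartite x v (flip v~x)) sv) 4≤x)

  -- Each pair of pebbles is available to more than h vertices. With 28 pairs that makes at least
  -- 28(h + 1) offers to at most 4h + 2 vertices, more than 7 each on average.
  solve-many : ∀ C → 28 ≤ halves C → Solved C
  solve-many C 28≤F =
    let v , 7<∑     = ∑-<⇒∃< (const 7) (λ v → ∑ (λ w → a G v w * ⌊ C w /2⌋)) more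
        C′ , s , le = collect G 8 C v 7<∑
    in  after G s (solve-8 C′ v (≤-trans (m≤n+m 8 (C v)) le))
    where
    open ≤-Reasoning
    count : ∀ h → (suc (h + h) + suc (h + h)) * 7 < suc h * 28
    count h = ≤-trans (m≤m+n (suc ((suc (h + h) + suc (h + h)) * 7)) 13) (≤-reflexive (identity h))
      where
      identity : ∀ h → suc ((suc (h + h) + suc (h + h)) * 7) + 13 ≡ suc h * 28
      identity = solve-∀
    column : ∀ w → suc h * ⌊ C w /2⌋ ≤ ∑ (λ v → a G v w * ⌊ C w /2⌋)
    column w = begin
      suc h * ⌊ C w /2⌋              ≤⟨ *-monoˡ-≤ ⌊ C w /2⌋ (min-degree w) ⟩
      ∑ (a G w) * ⌊ C w /2⌋          ≡⟨ *-distribʳ-sum ⌊ C w /2⌋ (a G w) ⟩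
      ∑ (λ v → a G w v * ⌊ C w /2⌋)  ≡⟨ sum-cong-≗ (λ v → cong (λ b → ⟦ b ⟧ * ⌊ C w /2⌋) (adj-sym G w v)) ⟩
      ∑ (λ v → a G v w * ⌊ C w /2⌋)  ∎
    more : ∑ {m + m} (const 7) < ∑ (λ v → ∑ (λ w → a G v w * ⌊ C w /2⌋))
    more = begin-strict
      ∑ {m + m} (const 7)                         ≡⟨ ∑-const (m + m) 7 ⟩
      (m + m) * 7                                 ≤⟨ *-monoˡ-≤ 7 (+-mono-≤ m≤1+2h m≤1+2h) ⟩
      (suc (h + h) + suc (h + h)) * 7             <⟨ count h ⟩
      suc h * 28                                  ≤⟨ *-monoʳ-≤ (suc h) 28≤F ⟩
      suc h * halves C                            ≡⟨ *-distribˡ-sum (suc h) (λ w → ⌊ C w /2⌋) ⟩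
      ∑ (λ w → suc h * ⌊ C w /2⌋)                 ≤⟨ ∑-mono column ⟩
      ∑ (λ w → ∑ (λ v → a G v w * ⌊ C w /2⌋))     ≡⟨ ∑-comm (λ w v → a G v w * ⌊ C w /2⌋) ⟩
      ∑ (λ v → ∑ (λ w → a G v w * ⌊ C w /2⌋))     ∎

  empties : Config (m + m) → ℕ
  empties C = ∑ (isZero ∘ C)

  -- Summing `c+isZero≤1+2⌊c/2⌋` over all vertices, the constant 1 contributes exactly the size of
  -- `C` and cancels.
  empties≤2halves : ∀ C → size C ≡ m + m → empties C ≤ halves C + halves C
  empties≤2halves C size≡ = +-cancelˡ-≤ (m + m) _ _ (begin
    m + m + empties C                                     ≡⟨ cong (_+ empties C) (trans (sym size≡) (listSum-allFin C)) ⟩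
    ∑ C + empties C                                       ≡⟨ ∑-distrib-+ C (isZero ∘ C) ⟨
    ∑ (λ v → C v + isZero (C v))                          ≤⟨ ∑-mono (c+isZero≤1+2⌊c/2⌋ ∘ C) ⟩
    ∑ (λ v → 1 + (⌊ C v /2⌋ + ⌊ C v /2⌋))                 ≡⟨ ∑-distrib-+ (const 1) (λ v → ⌊ C v /2⌋ + ⌊ C v /2⌋) ⟩
    ∑ {m + m} (const 1) + ∑ (λ v → ⌊ C v /2⌋ + ⌊ C v /2⌋) ≡⟨ cong₂ _+_ (trans (∑-const (m + m) 1) (*-identityʳ (m + m)))
                                                                     (∑-distrib-+ (λ v → ⌊ C v /2⌋) (λ v → ⌊ C v /2⌋)) ⟩
    m + m + (halves C + halves C)                         ∎)
    where open ≤-Reasoning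

  -- Two pairs of pebbles and few empty vertices

  ∑-add-δ : ∀ (bad : V → ℕ) u → ∑ (λ v → bad v + δ u v) ≡ suc (∑ bad)
  ∑-add-δ bad u = trans (∑-distrib-+ bad (δ u)) (trans (cong (∑ bad +_) (∑-δ u)) (+-comm (∑ bad) 1))

  -- `bad` is a parameter because preparatory moves may empty further vertices: 56 is 54 plus one
  -- for each of at most two such moves.
  two-sources : ∀ C bad → Covers C bad → ∑ bad ≤ 56 → ∀ u u′ → u ≢ u′ →
    side m u ≡ side m r → side m u′ ≡ side m r → 2 ≤ C u → 2 ≤ C u′ → Solved C
  two-sources C bad covers few u u′ u≢u′ su su′ 2≤u 2≤u′ =
    let v , u~v , bad-v = nbr-avoiding bad (≤-trans few (m≤m+n 56 112)) u in
    via v u~v (covers v bad-v)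
    where
    -- The sources are marked too, so that a chosen `w` differs from both and does not use their
    -- pairs.
    bad₂ : V → ℕ
    bad₂ w = bad w + δ u w + δ u′ w

    module Via (v : V) (u~v : u ~ v) (1≤v : 1 ≤ C v) (v≁r : ¬ v ~ r) where

      -- A path from `v` to `r` through `w` and `x`, with `w` pebbled; `x` may be empty.
      Link : V → V → Set
      Link x w = v ~ w × bad₂ w ≡ 0 × w ~ x × r ~ x

      link? : ∀ x w → Dec (Link x w)
      link? x w = T? _ ×-dec (bad₂ w ≟ⁿ 0) ×-dec T? _ ×-dec T? _

      sw : ∀ {w} → v ~ w → side m w ≡ side m r
      sw v~w = trans (sym (same-side u~v v~w)) su

      -- A neighbour `w` of `v` not marked by `bad₂` has a link, through a common neighbour of `w`
      -- and `r`. With at most `∑ bad` links, the degree of `v` would be at most 58 + 56 = 114,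
      -- hence at most h.
      many : ∑ bad < ∑ (λ x → ∑ (λ w → 𝟙 (link? x w)))
      many = ≰⇒> λ le → <⇒≱ (min-degree v) (begin
        ∑ (a G v)                                       ≤⟨ ∑-mono pointwise ⟩
        ∑ (λ w → bad₂ w + ∑ (λ x → 𝟙 (link? x w)))      ≡⟨ ∑-distrib-+ bad₂ (λ w → ∑ (λ x → 𝟙 (link? x w))) ⟩
        ∑ bad₂ + ∑ (λ w → ∑ (λ x → 𝟙 (link? x w)))      ≡⟨ cong₂ _+_ ∑bad₂ (∑-comm (λ w x → 𝟙 (link? x w))) ⟩
        2 + ∑ bad + ∑ (λ x → ∑ (λ w → 𝟙 (link? x w)))   ≤⟨ +-mono-≤ (+-monoʳ-≤ 2 few) (≤-trans le few) ⟩
        114                                             ≤⟨ ≤-trans (m≤m+n 114 54) 168≤h ⟩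
        h                                               ∎)
        where
        open ≤-Reasoning
        ∑bad₂ : ∑ bad₂ ≡ 2 + ∑ bad
        ∑bad₂ = trans (∑-add-δ (λ w → bad w + δ u w) u′) (cong suc (∑-add-δ bad u))
        pointwise : ∀ w → a G v w ≤ bad₂ w + ∑ (λ x → 𝟙 (link? x w))
        pointwise w with T? (adj G v w) | bad₂ w ≟ⁿ 0
        ... | no  v≁w | _ = ≤-trans (≤-reflexive (¬T⇒⟦⟧≡0 v≁w)) z≤n
        ... | yes _   | no bad≢0 = ≤-trans (𝟙≤1 (T? (adj G v w))) (m≤n⇒m≤n+o _ (n≢0⇒n>0 bad≢0))
        ... | yes v~w | yes bad≡0 =
          let x , w~x , r~x = common w r (sw v~w) in
          m≤n⇒m≤o+n (bad₂ w) (≤-trans (𝟙≤1 (T? (adj G v w)))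
            (≤-trans (≤-reflexive (sym (𝟙-yes (link? x w) (v~w , bad≡0 , w~x , r~x))))
              (term≤∑ (λ x → 𝟙 (link? x w)) x)))

      opposite-u : ∀ {x} → r ~ x → x ≢ u
      opposite-u r~x refl = bipartite _ _ r~x (sym su)

      unpack : ∀ {w} → bad₂ w ≡ 0 → 1 ≤ C w × w ≢ u × w ≢ u′
      unpack {w} eq =
        covers w (m+n≡0⇒m≡0 (bad w) (m+n≡0⇒m≡0 (bad w + δ u w) eq)) ,
        δ≡0⇒≢ (m+n≡0⇒n≡0 (bad w) (m+n≡0⇒m≡0 (bad w + δ u w) eq)) ∘ sym ,
        δ≡0⇒≢ (m+n≡0⇒n≡0 (bad w + δ u w) eq) ∘ sym

      through : ∀ {w x} → v ~ w → bad₂ w ≡ 0 → w ~ x → r ~ x → 1 ≤ C x → Solved C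
      through v~w bad₂-w w~x r~x 1≤x =
        let 1≤w , w≢u , _ = unpack bad₂-w in
        solve₄ G C u~v v~w w~x (flip r~x) w≢u (opposite-u r~x)
          (λ { refl → v≁r (flip r~x) }) 2≤u 1≤v 1≤w 1≤x

      -- Two of `r`, `y`, `w` have a common pebbled neighbour. Either pair containing `r` solves `C`
      -- at once; the remaining pair gives a `t` through which `y` can feed `w`.
      connect : ∀ bad′ → Covers C bad′ → ∑ bad′ ≤ 58 → ∀ {y w} → side m y ≡ side m r → 2 ≤ C y →
        v ~ w → bad₂ w ≡ 0 → Solved C ⊎ ∃ λ t → bad′ t ≡ 0 × y ~ t × w ~ t
      connect bad′ covers′ few′ {y} {w} sy 2≤y v~w bad₂-w
        with two-of-three r y w bad′ (sym sy) (sym (sw v~w)) few′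
      ... | t , bad-t , inj₁ (r~t , y~t)        = inj₁ (solve₂ G C y~t (flip r~t) 2≤y (covers′ t bad-t))
      ... | t , bad-t , inj₂ (inj₁ (r~t , w~t)) = inj₁ (through v~w bad₂-w w~t r~t (covers′ t bad-t))
      ... | t , bad-t , inj₂ (inj₂ (y~t , w~t)) = inj₂ (t , bad-t , y~t , w~t)

      converge : ∀ {w w′ x} → w ≢ w′ → bad x ≢ 0 → Link x w → Link x w′ → Solved C
      converge {w} {w′} {x} w≢w′ bad-x (v~w , bad₂-w , w~x , r~x) (v~w′ , bad₂-w′ , w′~x , _)
        with connect bad covers (≤-trans few (m≤m+n 56 2)) su 2≤u v~w bad₂-w
      ... | inj₁ solved = solved
      ... | inj₂ (t , bad-t , u~t , w~t)
        -- Marking `t` forces `t′ ≢ t`, since the first relay spends the pebble on `t`.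
        with connect (λ s → bad s + δ t s) (λ s eq → covers s (m+n≡0⇒m≡0 (bad s) eq))
               (≤-trans (≤-reflexive (∑-add-δ bad t)) (s≤s (≤-trans few (m≤m+n 56 1))))
               su′ 2≤u′ v~w′ bad₂-w′
      ... | inj₁ solved = solved
      ... | inj₂ (t′ , bad-t′ , u′~t′ , w′~t′) =
        let 1≤w , w≢u , w≢u′ = unpack bad₂-w
            1≤w′ , w′≢u , w′≢u′ = unpack bad₂-w′
            t≢t′ = δ≡0⇒≢ (m+n≡0⇒n≡0 (bad t′) bad-t′)
            st : side m t ≢ side m r
            st eq = bipartite _ _ u~t (trans su (sym eq))
            st′ : side m t′ ≢ side m r
            st′ eq = bipartite _ _ u′~t′ (trans su′ (sym eq))
            bad-t′₀ = m+n≡0⇒m≡0 (bad t′) bad-t′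
            C₁ , s₁ , x₁ , keep = relay G C u~t (flip w~t) w~x w≢u (opposite-u r~x)
              (λ { refl → bad-x bad-t }) 2≤u (covers t bad-t) 1≤w
            -- The first relay takes nothing from `u′`, `t′` and `w′`: `t` and `t′` lie in the part
            -- opposite to the sources and to `w` and `w′`, and the remaining pairs are distinct by
            -- choice.
            C₂ , s₂ , x₂ , _ = relay G C₁ u′~t′ (flip w′~t′) w′~x w′≢u′
              (λ { refl → bipartite _ _ r~x (sym su′) }) (λ { refl → bad-x bad-t′₀ })
              (≤-trans 2≤u′ (keep u′ (u≢u′ ∘ sym) (λ { refl → st su′ }) (w≢u′ ∘ sym)))
              (≤-trans (covers t′ bad-t′₀) (keep t′ (λ { refl → st′ su }) (t≢t′ ∘ sym) (λ { refl → st′ (sw v~w) })))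
              (≤-trans 1≤w′ (keep w′ w′≢u (λ { refl → st (sw v~w′) }) (w≢w′ ∘ sym)))
        in  after G s₁ (after G s₂ (solve₁ G C₂ (flip r~x) (≤-trans (s≤s (≤-trans (s≤s z≤n) x₁)) x₂)))

      conclude : Solved C
      conclude with ∑-<⇒∃< bad (λ x → ∑ (λ w → 𝟙 (link? x w))) many
      ... | x , lt with ∑-pos⇒∃pos (λ w → 𝟙 (link? x w)) (≤-trans (s≤s z≤n) lt)
      ... | w , pos with 𝟙-pos (link? x w) pos | bad x ≟ⁿ 0
      ... | v~w , bad₂-w , w~x , r~x | yes bad-x = through v~w bad₂-w w~x r~x (covers x bad-x)
      ... | link | no bad-x =
        -- More than `bad x`, hence at least two, links end at `x`, so one of them uses a `w′` other
        -- than `w`.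
        let w′ , lt′ = ∑-<⇒∃< (δ w) (λ w → 𝟙 (link? x w))
              (≤-<-trans (≤-trans (≤-reflexive (∑-δ w)) (n≢0⇒n>0 bad-x)) lt)
        in  converge (δ≡0⇒≢ (n≤0⇒n≡0 (s≤s⁻¹ (≤-trans lt′ (𝟙≤1 (link? x w′))))))
              bad-x link (𝟙-pos (link? x w′) (≤-trans (s≤s z≤n) lt′))

    via : ∀ v → u ~ v → 1 ≤ C v → Solved C
    via v u~v 1≤v with T? (adj G v r)
    ... | yes v~r = solve₂ G C u~v v~r 2≤u 1≤v
    ... | no  v≁r = Via.conclude v u~v 1≤v v≁r

  -- Only the source of a move loses pebbles, so marking `y` is enough.
  covers-move : ∀ (C : Config (m + m)) bad → Covers C bad → ∀ y w → Covers (move C y w) (λ v → bad v + δ y v)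
  covers-move C bad covers y w v eq =
    ≤-trans (covers v (m+n≡0⇒m≡0 (bad v) eq)) (move-≢ C y w (δ≡0⇒≢ (m+n≡0⇒n≡0 (bad v) eq) ∘ sym))

  -- Brings a pair from the other part into the part of `r`, by a move onto a pebbled neighbour.
  -- Avoiding `z` keeps the new source apart from the other one.
  ascend : ∀ C bad → Covers C bad → ∑ bad ≤ 55 → ∀ z {y} → side m y ≢ side m r →
    ∃ λ w → w ≢ z × side m w ≡ side m r × y ~ w × 2 ≤ move C y w w
  ascend C bad covers few z {y} sy =
    let w , y~w , eq = nbr-avoiding (λ v → bad v + δ z v)
          (≤-trans (≤-reflexive (∑-add-δ bad z)) (s≤s (≤-trans few (m≤m+n 55 112)))) y
    in  w , δ≡0⇒≢ (m+n≡0⇒n≡0 (bad w) eq) ∘ sym , ≢-≢⇒≡ (bipartite _ _ (flip y~w)) sy , y~w ,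
        ≤-trans (s≤s (covers w (m+n≡0⇒m≡0 (bad w) eq))) (move⁺ G C y~w)

  source-and-unit : ∀ C bad → Covers C bad → ∑ bad ≤ 55 → ∀ u y → u ≢ y →
    side m u ≡ side m r → 2 ≤ C u → 2 ≤ C y → Solved C
  source-and-unit C bad covers few u y u≢y su 2≤u 2≤y with side m y ≟ᵇ side m r
  ... | yes sy = two-sources C bad covers (≤-trans few (n≤1+n 55)) u y u≢y su sy 2≤u 2≤y
  ... | no  sy =
    let w , w≢u , sw , y~w , 2≤w = ascend C bad covers few u sy
    in  after G (step y~w 2≤y ◅ ε)
          (two-sources (move C y w) (λ v → bad v + δ y v) (covers-move C bad covers y w)
            (≤-trans (≤-reflexive (∑-add-δ bad y)) (s≤s few))
            u w (w≢u ∘ sym) su sw (≤-trans 2≤u (move-≢ C y w u≢y)) 2≤w)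

  two-units : ∀ C bad → Covers C bad → ∑ bad ≤ 54 → 2 ≤ halves C → Solved C
  two-units C bad covers few 2≤F with ∑-pos⇒∃pos (λ v → ⌊ C v /2⌋) (≤-trans (s≤s z≤n) 2≤F)
  -- `δ y` accounts for the pair already found; the total of at least 2 exceeds it somewhere.
  ... | y , pos with ∑-<⇒∃< (δ y) (λ v → ⌊ C v /2⌋) (≤-trans (≤-reflexive (cong suc (∑-δ y))) 2≤F)
  ... | y′ , lt with side m y ≟ᵇ side m r | δ<-cases y y′ lt
  ... | yes sy | inj₁ (refl , 2≤f) = solve-4 C y sy (2≤⌊c/2⌋⇒4≤c 2≤f)
  ... | yes sy | inj₂ (y≢y′ , 1≤f) = source-and-unit C bad covers (≤-trans few (n≤1+n 54)) y y′ y≢y′ sy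
                                       (0<⌊c/2⌋⇒2≤c pos) (0<⌊c/2⌋⇒2≤c 1≤f)
  -- After the move `y′` still holds a pair: if it is `y` itself, it had four pebbles.
  ... | no  sy | cases =
    let w , w≢y′ , sw , y~w , 2≤w = ascend C bad covers (≤-trans few (n≤1+n 54)) y′ sy
    in  after G (step y~w (0<⌊c/2⌋⇒2≤c pos) ◅ ε)
          (source-and-unit (move C y w) (λ v → bad v + δ y v) (covers-move C bad covers y w)
            (≤-trans (≤-reflexive (∑-add-δ bad y)) (s≤s few))
            w y′ w≢y′ sw 2≤w (left w cases))
    where
    left : ∀ w → (y ≡ y′ × 2 ≤ ⌊ C y′ /2⌋) ⊎ (y ≢ y′ × 1 ≤ ⌊ C y′ /2⌋) → 2 ≤ move C y w y′
    left w (inj₁ (refl , 2≤f)) = ≤-trans (∸-monoˡ-≤ 2 (2≤⌊c/2⌋⇒4≤c 2≤f)) (≤-reflexive (sym (move-source C y w)))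
    left w (inj₂ (y≢y′ , 1≤f)) = ≤-trans (0<⌊c/2⌋⇒2≤c 1≤f) (move-≢ C y w (y≢y′ ∘ sym))

  -- At most one empty vertex besides the root

  module OneEmpty (C : Config (m + m)) (C-r : C r ≡ 0) (few : empties C ≤ 2) where

    -- Otherwise `r`, `z` and `t` would be three distinct empty vertices.
    1≤C : ∀ {z t} → C z ≡ 0 → z ≢ r → t ≢ r → t ≢ z → 1 ≤ C t
    1≤C {z} {t} C-z z≢r t≢r t≢z = n≢0⇒n>0 λ C-t → <⇒≱ (s≤s few) (begin
      3                                        ≡⟨ cong₂ _+_ (∑-δ r) (cong₂ _+_ (∑-δ z) (∑-δ t)) ⟨
      ∑ (δ r) + (∑ (δ z) + ∑ (δ t))            ≡⟨ cong (∑ (δ r) +_) (∑-distrib-+ (δ z) (δ t)) ⟨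
      ∑ (δ r) + ∑ (λ v → δ z v + δ t v)        ≡⟨ ∑-distrib-+ (δ r) (λ v → δ z v + δ t v) ⟨
      ∑ (λ v → δ r v + (δ z v + δ t v))        ≤⟨ ∑-mono (pointwise C-t) ⟩
      empties C                                ∎)
      where
      open ≤-Reasoning
      pointwise : C t ≡ 0 → ∀ v → δ r v + (δ z v + δ t v) ≤ isZero (C v)
      pointwise C-t v with r ≟ v | z ≟ v | t ≟ v
      ... | yes refl | yes refl | _        = ⊥-elim (z≢r refl)
      ... | yes refl | no _     | yes refl = ⊥-elim (t≢r refl)
      ... | no _     | yes refl | yes refl = ⊥-elim (t≢z refl)
      ... | yes refl | no _     | no _     rewrite C-r = ≤-refl
      ... | no _     | yes refl | no _     rewrite C-z = ≤-refl
      ... | no _     | no _     | yes refl rewrite C-t = ≤-refl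
      ... | no _     | no _     | no _     = z≤n

    pebbled-nbr : ∀ u → ∃ λ v → u ~ v × 1 ≤ C v
    pebbled-nbr u =
      let v , u~v , eq = nbr-avoiding (isZero ∘ C) (≤-trans few (m≤m+n 2 166)) u
      in  v , u~v , covers-isZero C v eq

    solve : ∀ y → 2 ≤ C y → Solved C
    solve y 2≤y with T? (adj G y r)
    ... | yes y~r = solve₁ G C y~r 2≤y
    ... | no  y≁r with side m y ≟ᵇ side m r
    ... | yes sy with common y r sy
    ...   | x , y~x , r~x with C x in C-x
    ...     | suc _ = solve₂ G C y~x (flip r~x) 2≤y (subst (1 ≤_) (sym C-x) (s≤s z≤n))
    -- Now `x` is the only empty vertex besides `r`. The detour `y`, `v`, `w`, `x′`, `r` avoids it:
    -- `v` and `x′` are chosen pebbled, and `w` lies in the other part than `x`.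
    ...     | zero with pebbled-nbr y | pebbled-nbr r
    ...       | v , y~v , 1≤v | x′ , r~x′ , 1≤x′ with T? (adj G v r)
    ...         | yes v~r = solve₂ G C y~v v~r 2≤y 1≤v
    ...         | no  v≁r with common v x′ (≢-≢⇒≡ (bipartite v y (flip y~v)) (λ eq → bipartite r x′ r~x′ (trans (sym sy) eq)))
    ...           | w , v~w , x′~w with w ≟ y
    ...             | yes refl = solve₂ G C (flip x′~w) (flip r~x′) 2≤y 1≤x′
    ...             | no  w≢y  = solve₄ G C y~v v~w (flip x′~w) (flip r~x′) w≢y
                        (λ { refl → y≁r (flip r~x′) }) (λ { refl → v≁r (flip r~x′) }) 2≤y 1≤v
                        (1≤C C-x (adj⇒≢ G r~x ∘ sym) (λ { refl → v≁r v~w })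
                          (λ { refl → bipartite r w r~x (same-side r~x′ x′~w) }))
                        1≤x′
    solve y 2≤y | no y≁r | no sy with pebbled-nbr r
    ... | x′ , r~x′ , 1≤x′ with common y x′ (≢-≢⇒≡ sy (bipartite r x′ r~x′))
    ...   | w , y~w , x′~w with C w in C-w
    ...     | suc _ = solve₃ G C y~w (flip x′~w) (flip r~x′) (λ { refl → y≁r (flip r~x′) }) 2≤y
                        (subst (1 ≤_) (sym C-w) (s≤s z≤n)) 1≤x′
    -- Here `w` is the only empty vertex besides `r`; since `w` is in the part of `r` and `x₂` is
    -- not, `x₂` is pebbled.
    ...     | zero with pebbled-nbr y
    ...       | w₂ , y~w₂ , 1≤w₂ with common w₂ r (≢-≢⇒≡ (bipartite w₂ y (flip y~w₂)) sy)
    ...         | x₂ , w₂~x₂ , r~x₂ = solve₃ G C y~w₂ w₂~x₂ (flip r~x₂) (λ { refl → y≁r (flip r~x₂) }) 2≤y 1≤w₂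
                    (1≤C C-w (λ { refl → y≁r y~w }) (adj⇒≢ G r~x₂ ∘ sym)
                      (λ { refl → bipartite r x₂ r~x₂ (same-side r~x′ x′~w) }))

  solvable : ∀ C → size C ≡ m + m → Solved C
  solvable C size≡ with C r in C-r
  ... | suc _ = C , ε , subst (1 ≤_) (sym C-r) (s≤s z≤n)
  ... | zero with 28 ≤? halves C | 2 ≤? halves C
  ...   | yes 28≤F | _       = solve-many C 28≤F
  ...   | no  28≰F | yes 2≤F = two-units C (isZero ∘ C) (covers-isZero C)
          (≤-trans (empties≤2halves C size≡) (+-mono-≤ F≤27 F≤27)) 2≤F
    where
    F≤27 = s≤s⁻¹ (≰⇒> 28≰F)
  ...   | no  _    | no  2≰F =
    -- The empty root makes `empties C`, hence `halves C`, positive.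
    let y , pos = ∑-pos⇒∃pos (λ v → ⌊ C v /2⌋) (halves-pos (≤-trans 1≤E (empties≤2halves C size≡)))
    in  OneEmpty.solve C C-r (≤-trans (empties≤2halves C size≡) (+-mono-≤ F≤1 F≤1)) y (0<⌊c/2⌋⇒2≤c pos)
    where
    F≤1 = s≤s⁻¹ (≰⇒> 2≰F)
    1≤E : 1 ≤ empties C
    1≤E = subst (λ c → isZero c ≤ empties C) C-r (term≤∑ (isZero ∘ C) r)
    halves-pos : ∀ {f} → 1 ≤ f + f → 0 < f
    halves-pos {suc f} _ = s≤s z≤n

-- Sharpness

∑-↑ : ∀ k {l} (f : Fin (k + l) → ℕ) → ∑ f ≡ ∑ (f ∘ (_↑ˡ l)) + ∑ (f ∘ (k ↑ʳ_))
∑-↑ zero    f = refl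
∑-↑ (suc k) f = trans (cong (f zero +_) (∑-↑ k (f ∘ suc))) (sym (+-assoc (f zero) _ _))

-- `far` marks the vertices beyond the cut vertex `x`: by `separates`, only edges at `x` lead from
-- the near side to the far side.
module CutVertex {n} (G : Graph n) (x y r : Fin n) (far : Fin n → Bool)
  (separates : ∀ u v → Adj G u v → u ≢ x → far u ≡ false → far v ≡ false)
  (far-x : far x ≡ false) (far-y : far y ≡ false) (far-r : far r ≡ true) (x≢y : x ≢ y) where

  -- Its sum bounds the pebbles that can accumulate on x: no move from the side of
  -- y increases it.
  φ : Config n → Fin n → ℕ
  φ D v = if does (v ≟ x) then D v else ⌊ D v /2⌋

  -- An invariant of pebbling: the first clause keeps `x` from holding a pair, the second keeps far
  -- vertices from moving, so `r` is never fed.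
  Stuck : Config n → Set
  Stuck D = ∑ (φ D) ≤ 1 × (∀ v → far v ≡ true → D v ≤ 1) × D r ≡ 0

  far-≢ : ∀ {u v} → far u ≡ true → far v ≡ false → u ≢ v
  far-≢ fu fv refl with () ← trans (sym fu) fv

  -- The source loses one half and the target gains at most one, whether or not it is `x`. Adding
  -- `δ` on both sides avoids subtraction.
  φ-move : ∀ D {u v} → u ≢ x → u ≢ v → 2 ≤ D u → ∀ t → φ (move D u v) t + δ u t ≤ φ D t + δ v t
  φ-move D {u} {v} u≢x u≢v 2≤u t with t ≟ u
  ... | yes refl rewrite δ-refl t | dec-false (t ≟ x) u≢x = m≤n⇒m≤n+o _ (lose 2≤u)
    where
    lose : ∀ {c} → 2 ≤ c → ⌊ c ∸ 2 /2⌋ + 1 ≤ ⌊ c /2⌋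
    lose (s≤s (s≤s _)) = ≤-reflexive (+-comm _ 1)
  ... | no t≢u rewrite δ-≢ (t≢u ∘ sym) with t ≟ v | t ≟ x
  ...   | yes refl | yes _ rewrite δ-refl t = ≤-reflexive (trans (+-identityʳ _) (+-comm 1 _))
  ...   | yes refl | no  _ rewrite δ-refl t = ≤-trans (≤-reflexive (+-identityʳ _))
                               (≤-trans (⌊n/2⌋-mono (n≤1+n _)) (≤-reflexive (+-comm 1 _)))
  ...   | no  _    | yes _ = +-monoʳ-≤ _ z≤n
  ...   | no  _    | no  _ = +-monoʳ-≤ _ z≤n

  stuck-step : ∀ {D D′} → Step G D D′ → Stuck D → Stuck D′
  stuck-step {D} (step {u} {v} u~v 2≤u) (∑≤1 , far≤1 , D-r) =
    ≤-trans ∑-move ∑≤1 ,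
    (λ t ft → ≤-trans (≤-reflexive (fixed ft)) (far≤1 t ft)) ,
    trans (fixed far-r) D-r
    where
    u≢x : u ≢ x
    u≢x refl = <⇒≱ 2≤u (≤-trans (≤-trans (≤-reflexive φ-x) (term≤∑ (φ D) u)) ∑≤1)
      where
      φ-x : D u ≡ φ D u
      φ-x rewrite dec-true (u ≟ u) refl = refl
    far-u : far u ≡ false
    far-u = ¬-not (λ fu → <⇒≱ 2≤u (far≤1 u fu))
    fixed : ∀ {t} → far t ≡ true → move D u v t ≡ D t
    fixed ft = move-≢≢ D u v (far-≢ ft far-u) (far-≢ ft (separates u v u~v u≢x far-u))
    ∑-move : ∑ (φ (move D u v)) ≤ ∑ (φ D)
    ∑-move = +-cancelʳ-≤ 1 _ _ (begin
      ∑ (φ (move D u v)) + 1                 ≡⟨ cong (∑ (φ (move D u v)) +_) (∑-δ u) ⟨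
      ∑ (φ (move D u v)) + ∑ (δ u)           ≡⟨ ∑-distrib-+ (φ (move D u v)) (δ u) ⟨
      ∑ (λ t → φ (move D u v) t + δ u t)     ≤⟨ ∑-mono (φ-move D u≢x (adj⇒≢ G u~v) 2≤u) ⟩
      ∑ (λ t → φ D t + δ v t)                ≡⟨ ∑-distrib-+ (φ D) (δ v) ⟩
      ∑ (φ D) + ∑ (δ v)                      ≡⟨ cong (∑ (φ D) +_) (∑-δ v) ⟩
      ∑ (φ D) + 1                            ∎)
      where open ≤-Reasoning

  stuck-star : ∀ {D D′} → Star (Step G) D D′ → Stuck D → Stuck D′
  stuck-star ε        st = st
  stuck-star (s ◅ ss) st = stuck-star ss (stuck-step s st)

  C : Config n
  C v = suc (δ y v + δ y v) ∸ (δ x v + δ r v)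

  r≢x : r ≢ x
  r≢x = far-≢ far-r far-x

  r≢y : r ≢ y
  r≢y = far-≢ far-r far-y

  size-C : size C ≡ n
  size-C = trans (listSum-allFin C) (+-cancelʳ-≡ 2 _ _ (begin
    ∑ C + 2                                   ≡⟨ cong (∑ C +_) (cong₂ _+_ (∑-δ x) (∑-δ r)) ⟨
    ∑ C + (∑ (δ x) + ∑ (δ r))                 ≡⟨ cong (∑ C +_) (∑-distrib-+ (δ x) (δ r)) ⟨
    ∑ C + ∑ (λ v → δ x v + δ r v)             ≡⟨ ∑-distrib-+ C (λ v → δ x v + δ r v) ⟨
    ∑ (λ v → C v + (δ x v + δ r v))           ≡⟨ sum-cong-≗ (λ v → m∸n+n≡m (fits v)) ⟩
    ∑ (λ v → 1 + (δ y v + δ y v))             ≡⟨ ∑-distrib-+ (const 1) (λ v → δ y v + δ y v) ⟩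
    ∑ {n} (const 1) + ∑ (λ v → δ y v + δ y v) ≡⟨ cong₂ _+_ (trans (∑-const n 1) (*-identityʳ n)) (∑-distrib-+ (δ y) (δ y)) ⟩
    n + (∑ (δ y) + ∑ (δ y))                   ≡⟨ cong (n +_) (cong₂ _+_ (∑-δ y) (∑-δ y)) ⟩
    n + 2                                     ∎))
    where
    open ≡-Reasoning
    -- The truncated subtraction in `C` is exact: as `r ≢ x`, at most one pebble is taken from any
    -- vertex.
    fits : ∀ v → δ x v + δ r v ≤ suc (δ y v + δ y v)
    fits v with x ≟ v | r ≟ v
    ... | yes refl | yes refl = ⊥-elim (r≢x refl)
    ... | yes _    | no  _    = s≤s z≤n
    ... | no  _    | yes _    = s≤s z≤n
    ... | no  _    | no  _    = z≤n

  stuck-C : Stuck C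
  stuck-C = ≤-trans (∑-mono φ≤δ) (≤-reflexive (∑-δ y)) , far≤1 , C-r
    where
    -- The three pebbles on `y` weigh 1, single pebbles off `x` weigh 0, and `x` is empty.
    φ≤δ : ∀ v → φ C v ≤ δ y v
    φ≤δ v with v ≟ x | y ≟ v
    ... | yes refl | yes refl = ⊥-elim (x≢y refl)
    ... | yes refl | no  _    rewrite δ-refl v = ≤-reflexive (0∸n≡0 (δ r v))
    ... | no  _    | yes refl = ⌊n/2⌋-mono {3 ∸ (δ x v + δ r v)} {3} (m∸n≤m 3 (δ x v + δ r v))
    ... | no  _    | no  _    = ⌊n/2⌋-mono {1 ∸ (δ x v + δ r v)} {1} (m∸n≤m 1 (δ x v + δ r v))
    far≤1 : ∀ v → far v ≡ true → C v ≤ 1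
    far≤1 v fv rewrite δ-≢ (far-≢ fv far-y ∘ sym) = m∸n≤m 1 (δ x v + δ r v)
    C-r : C r ≡ 0
    C-r rewrite δ-≢ (r≢y ∘ sym) | δ-≢ (r≢x ∘ sym) | δ-refl r = refl

  ¬AllSolvable : ¬ AllSolvable G n
  ¬AllSolvable all =
    let D , s , 1≤r       = all C size-C r
        _ , _ , D-r       = stuck-star s stuck-C
    in  n≮0 (subst (1 ≤_) D-r 1≤r)

-- Reduces on the first argument to `c` or `not c`, so that row sums count a block or its
-- complement.
_==_ : Bool → Bool → Bool
true  == c = c
false == c = not c

==⇒≡ : ∀ {b c} → T (b == c) → b ≡ c
==⇒≡ {true}  {true}  _ = refl
==⇒≡ {false} {false} _ = refl

==-comm : ∀ b c → b == c ≡ c == b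
==-comm true  true  = refl
==-comm true  false = refl
==-comm false true  = refl
==-comm false false = refl

<ᵇ≡isLeft-splitAt : ∀ k {l} (i : Fin (k + l)) → (toℕ i <ᵇ k) ≡ is-just (isInj₁ (splitAt k i))
<ᵇ≡isLeft-splitAt zero    i       = refl
<ᵇ≡isLeft-splitAt (suc k) zero    = refl
<ᵇ≡isLeft-splitAt (suc k) (suc i) with splitAt k i | <ᵇ≡isLeft-splitAt k i
... | inj₁ _ | eq = eq
... | inj₂ _ | eq = eq

-- Two complete bipartite blocks, with the first vertex of the first part
-- joined to the whole second part; that vertex is a cut vertex.
module Hub (m′ h : ℕ) (1≤h : 1 ≤ h) (2h≤m : h + h ≤ suc m′) where

  m : ℕ
  m = suc m′

  h<m : h < m
  h<m = ≤-trans (+-monoˡ-≤ h 1≤h) 2h≤m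

  -- Splits both parts by index: `h` indices in the first block, the other m - h ≥ h in the second.
  block : Fin m → Bool
  block i = toℕ i <ᵇ h

  block-zero : block zero ≡ true
  block-zero = positive 1≤h
    where
    positive : ∀ {k} → 1 ≤ k → (0 <ᵇ k) ≡ true
    positive (s≤s _) = refl

  E : Fin m → Fin m → Bool
  E zero    j = true
  E (suc i) j = block (suc i) == block j

  edge : Fin m ⊎ Fin m → Fin m ⊎ Fin m → Bool
  edge (inj₁ i) (inj₁ _) = false
  edge (inj₁ i) (inj₂ j) = E i j
  edge (inj₂ j) (inj₁ i) = E i j
  edge (inj₂ j) (inj₂ _) = false

  edge-sym : ∀ p q → edge p q ≡ edge q p
  edge-sym (inj₁ _) (inj₁ _) = refl
  edge-sym (inj₁ _) (inj₂ _) = refl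
  edge-sym (inj₂ _) (inj₁ _) = refl
  edge-sym (inj₂ _) (inj₂ _) = refl

  edge-irrefl : ∀ p → edge p p ≡ false
  edge-irrefl (inj₁ _) = refl
  edge-irrefl (inj₂ _) = refl

  G : Graph (m + m)
  G .adj u v   = edge (splitAt m u) (splitAt m v)
  G .adj-sym u v = edge-sym (splitAt m u) (splitAt m v)
  G .irrefl v  = edge-irrefl (splitAt m v)

  bipartite : ∀ u v → Adj G u v → side m u ≢ side m v
  bipartite u v u~v eq = edge-sides (splitAt m u) (splitAt m v) u~v
    (trans (sym (<ᵇ≡isLeft-splitAt m u)) (trans eq (<ᵇ≡isLeft-splitAt m v)))
    where
    edge-sides : ∀ p q → T (edge p q) → is-just (isInj₁ p) ≢ is-just (isInj₁ q)
    edge-sides (inj₁ _) (inj₂ _) _ ()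
    edge-sides (inj₂ _) (inj₁ _) _ ()

  ∑-block : ∀ b → h ≤ ∑ (λ j → ⟦ b == block j ⟧)
  ∑-block true  = ≤-reflexive (sym (∑-<ᵇ h (<⇒≤ h<m)))
  ∑-block false = +-cancelˡ-≤ h _ _ (≤-trans 2h≤m (≤-reflexive
    (trans (sym (∑-not block)) (cong (_+ ∑ (λ j → ⟦ not (block j) ⟧)) (∑-<ᵇ h (<⇒≤ h<m))))))

  ==≤E : ∀ i j → ⟦ block i == block j ⟧ ≤ ⟦ E i j ⟧
  ==≤E zero    j = 𝟙≤1 (T? (block zero == block j))
  ==≤E (suc i) j = ≤-refl

  ∑-edge : ∀ p → h ≤ ∑ (λ v → ⟦ edge p (splitAt m v) ⟧)
  ∑-edge p = ≤-trans (half p) (≤-reflexive (sym (∑-↑ m (row p))))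
    where
    row : Fin m ⊎ Fin m → Fin (m + m) → ℕ
    row p v = ⟦ edge p (splitAt m v) ⟧
    half : ∀ p → h ≤ ∑ {m} (row p ∘ (_↑ˡ m)) + ∑ (row p ∘ (m ↑ʳ_))
    half (inj₁ i) = m≤n⇒m≤o+n (∑ {m} (row (inj₁ i) ∘ (_↑ˡ m))) (≤-trans (∑-block (block i))
      (∑-mono λ j → ≤-trans (==≤E i j) (≤-reflexive (cong (⟦_⟧ ∘ edge (inj₁ i)) (sym (splitAt-↑ʳ m m j))))))
    half (inj₂ j) = m≤n⇒m≤n+o (∑ (row (inj₂ j) ∘ (m ↑ʳ_))) (≤-trans (∑-block (block j))
      (∑-mono λ i → ≤-trans (≤-reflexive (cong ⟦_⟧ (==-comm (block j) (block i))))
        (≤-trans (==≤E i j) (≤-reflexive (cong (⟦_⟧ ∘ edge (inj₂ j)) (sym (splitAt-↑ˡ m i m)))))))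

  min-degree : MinDegreeAtLeast G h
  min-degree v = ≤-trans (∑-edge (splitAt m v)) (≤-reflexive (sym (listSum-allFin (a G v))))

  hub : Fin (m + m)
  hub = zero

  -- The hub is adjacent to the whole second part, and a vertex of the first part has a neighbour
  -- there.
  to-hub : ∀ u → Star (Adj G) u hub
  to-hub u with ∑-pos⇒∃pos (a G u) (≤-trans 1≤h (∑-edge (splitAt m u)))
  ... | w , pos with 𝟙-pos (T? (adj G u w)) pos
  ... | u~w with splitAt m u in eq-u | splitAt m w in eq-w
  ... | inj₂ j | _      = subst T (sym (cong (λ p → edge p (inj₁ zero)) eq-u)) tt ◅ ε
  ... | inj₁ i | inj₂ j = _◅_ {j = w} (subst T (sym (cong₂ edge eq-u eq-w)) u~w)
                            (subst T (sym (cong (λ p → edge p (inj₁ zero)) eq-w)) tt ◅ ε)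

  connected : Connected G
  connected u v = to-hub u ◅◅ reverse (λ {i} {j} → adj-flip G {i} {j}) (to-hub v)

  far : Fin (m + m) → Bool
  far v = not (block (reduce (splitAt m v)))

  -- Edges that avoid the hub stay within a block, and the hub itself is near.
  separates : ∀ u v → Adj G u v → u ≢ hub → far u ≡ false → far v ≡ false
  separates u v u~v u≢hub = edge-far (splitAt m u) (splitAt m v) refl u~v
    where
    edge-far : ∀ p q → splitAt m u ≡ p → T (edge p q) →
               not (block (reduce p)) ≡ false → not (block (reduce q)) ≡ false
    edge-far (inj₁ zero)    (inj₂ j)       eq _ _  = ⊥-elim (u≢hub (sym (splitAt⁻¹-↑ˡ eq)))
    edge-far (inj₁ (suc i)) (inj₂ j)       _  t fp = trans (cong not (sym (==⇒≡ {block (suc i)} t))) fp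
    edge-far (inj₂ j)       (inj₁ zero)    _  _ _  = cong not block-zero
    edge-far (inj₂ j)       (inj₁ (suc i)) _  t fp = trans (cong not (==⇒≡ {block (suc i)} t)) fp

  y r : Fin (m + m)
  y = m ↑ʳ zero
  -- Index `h` is the first one outside the first block.
  r = fromℕ< h<m ↑ˡ m

  far-y : far y ≡ false
  far-y rewrite splitAt-↑ʳ m m zero = cong not block-zero

  far-r : far r ≡ true
  far-r rewrite splitAt-↑ˡ m (fromℕ< h<m) m | toℕ-fromℕ< h<m = cong not (<ᵇ-irrefl h)
    where
    <ᵇ-irrefl : ∀ k → (k <ᵇ k) ≡ false
    <ᵇ-irrefl zero    = refl
    <ᵇ-irrefl (suc k) = <ᵇ-irrefl k

  ¬class0 : ¬ Class0 G
  ¬class0 (all , _) = CutVertex.¬AllSolvable G hub y r far separates (cong not block-zero) far-y far-r (λ ()) all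

theorem1 : (m : ℕ) → 336 ≤ m →
    ((G : Graph (m + m)) → InB m G → MinDegreeAtLeast G (m / 2 + 1) → Class0 G)
    × Σ (Graph (m + m)) (λ G → InB m G × MinDegreeAtLeast G (m / 2) × ¬ Class0 G)
theorem1 m@(suc m′) 336≤m =
  (λ G (bipartite , _) min-degree →
    (λ C size≡ r → Dense.solvable m h 168≤h m≤1+2h G bipartite (dense G min-degree) r C size≡) ,
    ¬AllSolvable-< G) ,
  Hub.G m′ h 1≤h 2h≤m ,
  (Hub.bipartite m′ h 1≤h 2h≤m , Hub.connected m′ h 1≤h 2h≤m) ,
  Hub.min-degree m′ h 1≤h 2h≤m , Hub.¬class0 m′ h 1≤h 2h≤m
  where
  h = m / 2
  168≤h : 168 ≤ h
  168≤h = /-monoˡ-≤ 2 336≤m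
  1≤h : 1 ≤ h
  1≤h = ≤-trans (s≤s z≤n) 168≤h
  h*2≡h+h : h * 2 ≡ h + h
  h*2≡h+h = trans (*-comm h 2) (cong (h +_) (+-identityʳ h))
  2h≤m : h + h ≤ m
  2h≤m = ≤-trans (≤-reflexive (sym h*2≡h+h)) (m/n*n≤m m 2)
  m≤1+2h : m ≤ suc (h + h)
  m≤1+2h = ≤-trans (≤-reflexive (trans (m≡m%n+[m/n]*n m 2) (cong (m % 2 +_) h*2≡h+h)))
    (+-monoˡ-≤ (h + h) (s≤s⁻¹ (m%n<n m 2)))
  dense : ∀ G → MinDegreeAtLeast G (h + 1) → ∀ u → h < ∑ (a G u)
  dense G min-degree u = ≤-trans (≤-reflexive (+-comm 1 h))
    (≤-trans (min-degree u) (≤-reflexive (listSum-allFin (a G u))))
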